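{- Let $\nu$ be a probability measure on the Cantor space $\mathbf C$. A set $X\subseteq\mathbf C$ is all-$\nu$-measurable if and only if it is (classically) $\nu$-measurable, in which case $\nu_{\mathrm{all}}(X)=\nu(X)$.
   Context: $\mathbb N=\{0,1,2,\dots\}$. $\{0,1\}^*$ is the set of finite binary strings, $\lambda$ the empty string. $w\sqsubseteq x$ means that $w$ is a prefix of $x$. $\mathbf C$ is the Cantor space of all infinite binary sequences $A$; $A[0..n-1]$ is the $n$-bit prefix of $A$. $X^{c}=\mathbf C\setminus X$. For $w\in\{0,1\}^*$, $\mathbf C_w=\{A\in\mathbf C: w\sqsubseteq A\}$. A probability measure on $\mathbf C$ is a function $\nu:\{0,1\}^*\to[0,1]$ with $\nu(\lambda)=1$ and $\nu(w)=\nu(w0)+\nu(w1)$ for all $w$. A $\nu$-martingale is a function $d:\{0,1\}^*\to[0,\infty)$ with $d(w)\nu(w)=d(w0)\nu(w0)+d(w1)\nu(w1)$ for all $w$; $\mathcal D_\nu$ is the set of all $\nu$-martingales. $\mathbf 1$ is the martingale with $\mathbf 1(w)=1$ for all $w$. $S^1[d]=\{A\in\mathbf C:\exists n\in\mathbb N,\ d(A[0..n-1])\ge 1\}$. Classical notions. A prefix set is a set of strings no element of which is a proper prefix of another element. An open set is a set of the form $\mathbf C_B=\bigcup_{w\in B}\mathbf C_w$ with $B\subseteq\{0,1\}^*$; $B$ can always be chosen to be a prefix set, and then $\nu(\mathbf C_B)=\sum_{w\in B}\nu(w)$ (independent of the choice of prefix set). The outer $\nu$-measure of $X\subseteq\mathbf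 C$ is $\nu^*(X)=\inf\{\nu(Y): Y\text{ open},\ X\subseteq Y\}$. $X$ is $\nu$-measurable if $\nu^*(Y)=\nu^*(Y\cap X)+\nu^*(Y\setminus X)$ for every $Y\subseteq\mathbf C$; then $\nu(X)=\nu^*(X)$. Resource-bounded notions for the resource bound "all" (which imposes no computability restriction). For disjoint $X^+,X^-\subseteq\mathbf C$, a $\nu$-splitting operator for $(X^+,X^-)$ is a functional $\Phi:\mathbb N\times\mathcal D_\nu\to\mathcal D_\nu\times\mathcal D_\nu$, written $\Phi(r,d)=(\Phi^+_r(d),\Phi^-_r(d))$, such that for all $r\in\mathbb N$, $d\in\mathcal D_\nu$: (i) $X^+\cap S^1[d]\subseteq S^1[\Phi^+_r(d)]$; (ii) $X^-\cap S^1[d]\subseteq S^1[\Phi^-_r(d)]$; (iii) $\Phi^+_r(d)(\lambda)+\Phi^-_r(d)(\lambda)\le d(\lambda)+2^{ -r}$. An all-$\nu$-measurement of $X$ is a $\nu$-splitting operator for $(X,X^{c})$. $X$ is all-$\nu$-measurable if an all-$\nu$-measurement $\Phi$ of $X$ exists; then $\nu_{\mathrm{all}}(X)=\Phi^+_\infty:=\inf_{r\in\mathbb N}\Phi^+_r(\mathbf 1)(\lambda)$, which does not depend on the choice of $\Phi$. -}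

module Defs where

open import Algebra.Bundles using (CommutativeRing)
open import Algebra.Structures using (IsCommutativeRing)
import Algebra.Properties.AbelianGroup as AbelianGroupProperties
import Algebra.Properties.Ring as RingProperties
import Algebra.Properties.Semiring.Exp as Exp
open import Data.Bool using (Bool; true; false)
open import Data.List using (List; []; _∷_; _∷ʳ_; map; foldr; length; applyUpTo)
open import Data.List.Relation.Binary.Prefix.Heterogeneous using (Prefix; [])
open import Data.List.Relation.Unary.All using (All; []; _∷_)
open import Data.List.Relation.Unary.AllPairs using ([]; _∷_)
open import Data.List.Relation.Unary.Unique.Propositional using (Unique)
open import Data.Nat using (ℕ)
open import Data.Product using (Σ-syntax; ∃; _×_; _,_; proj₁; proj₂)
open import Data.Sum using (inj₁; inj₂)
open import Level using (0ℓ; suc; Lift; lift)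
open import Relation.Binary.Structures using (IsDecTotalOrder)
open import Relation.Binary.PropositionalEquality
  using (_≡_; _≢_; refl; sym; trans; cong; subst)
open import Relation.Nullary using (contradiction)
open import Relation.Nullary.Decidable using (recompute)
open import Relation.Unary using (Pred; _∈_; _⊆_; _≐_; _∩_; _∖_; ∁; _⊥_; Satisfiable)

-- The real numbers, characterised up to unique isomorphism as a Dedekind
-- complete ordered field.  Since the logic is classical in the theorem, the order
-- is taken decidable and inversion total (with 0# ⁻¹ arbitrary).
-- Completeness is for predicates one level up so that it applies to
-- sets of reals defined by quantification over subsets of Cantor space.
record CompleteOrderedField : Set (suc (suc 0ℓ)) where
  infix  8 -_
  infix  9 _⁻¹
  infixl 7 _*_
  infixl 6 _+_
  infix  4 _≤_
  field
    ℝ    : Set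
    _+_  : ℝ → ℝ → ℝ
    _*_  : ℝ → ℝ → ℝ
    -_   : ℝ → ℝ
    _⁻¹  : ℝ → ℝ
    0#   : ℝ
    1#   : ℝ
    _≤_  : ℝ → ℝ → Set

    isCommutativeRing : IsCommutativeRing _≡_ _+_ _*_ -_ 0# 1#
    0≢1               : 0# ≢ 1#
    ⁻¹-inverseʳ       : ∀ x → x ≢ 0# → x * x ⁻¹ ≡ 1#

    isDecTotalOrder   : IsDecTotalOrder _≡_ _≤_
    +-monoʳ-≤         : ∀ x {y z} → y ≤ z → x + y ≤ x + z
    *-nonneg          : ∀ {x y} → 0# ≤ x → 0# ≤ y → 0# ≤ x * y

  UpperBound : ∀ {ℓ} → Pred ℝ ℓ → Pred ℝ ℓ
  UpperBound P u = ∀ x → P x → x ≤ u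

  LowerBound : ∀ {ℓ} → Pred ℝ ℓ → Pred ℝ ℓ
  LowerBound P l = ∀ x → P x → l ≤ x

  IsSup : ∀ {ℓ} → Pred ℝ ℓ → Pred ℝ ℓ
  IsSup P s = UpperBound P s × LowerBound (UpperBound P) s

  IsInf : ∀ {ℓ} → Pred ℝ ℓ → Pred ℝ ℓ
  IsInf P i = LowerBound P i × UpperBound (LowerBound P) i

  field
    sup-complete : (P : Pred ℝ (suc 0ℓ)) →
                   Satisfiable P → Satisfiable (UpperBound P) → ∃ (IsSup P)

  commutativeRing : CommutativeRing 0ℓ 0ℓ
  commutativeRing = record { isCommutativeRing = isCommutativeRing }

  open CommutativeRing commutativeRing public
    using (ring; semiring; +-abelianGroup; +-identityʳ; -‿inverseˡ; distribˡ)

  open RingProperties ring using (-1*x≈-x)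
  open AbelianGroupProperties +-abelianGroup using (⁻¹-involutive)

  open IsDecTotalOrder isDecTotalOrder public
    using (_≟_; _≤?_; total)
    renaming (refl to ≤-refl; reflexive to ≤-reflexive; trans to ≤-trans; antisym to ≤-antisym)

  open Exp semiring public using (_^_)

  2^- : ℕ → ℝ
  2^- r = ((1# + 1#) ⁻¹) ^ r

  inf-complete : (P : Pred ℝ (suc 0ℓ)) →
                 Satisfiable P → Satisfiable (LowerBound P) → ∃ (IsInf P)
  inf-complete P (p , Pp) lower with sup-complete (LowerBound P) lower (p , λ l l≤ → l≤ p Pp)
  ... | i , ub , least = i , (λ x Px → least x (λ l l≤ → l≤ x Px)) , ub

  inf : (P : Pred ℝ (suc 0ℓ)) → Satisfiable P → Satisfiable (LowerBound P) → ℝ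
  inf P ne lb = proj₁ (inf-complete P ne lb)

  0≤1 : 0# ≤ 1#
  0≤1 with total 0# 1#
  ... | inj₁ 0≤1 = 0≤1
  ... | inj₂ 1≤0 = subst (0# ≤_) [-1][-1]≡1 (*-nonneg 0≤-1 0≤-1)
    where
    0≤-1 : 0# ≤ - 1#
    0≤-1 = subst (_≤ - 1#) (-‿inverseˡ 1#)
             (subst (- 1# + 1# ≤_) (+-identityʳ (- 1#)) (+-monoʳ-≤ (- 1#) 1≤0))
    [-1][-1]≡1 : - 1# * - 1# ≡ 1#
    [-1][-1]≡1 = trans (-1*x≈-x (- 1#)) (⁻¹-involutive 1#)

String : Set
String = List Bool

Cantor : Set
Cantor = ℕ → Bool

infixl 20 _↾_

_↾_ : Cantor → ℕ → String
A ↾ n = applyUpTo A n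

Cylinder : String → Pred Cantor 0ℓ
Cylinder w A = w ≡ A ↾ length w

Cylinders : Pred String 0ℓ → Pred Cantor 0ℓ
Cylinders B A = ∃ λ w → w ∈ B × A ∈ Cylinder w

PrefixSet : Pred String 0ℓ → Set
PrefixSet B = ∀ {u v} → u ∈ B → v ∈ B → Prefix _≡_ u v → u ≡ v

record ProbabilityMeasure (R : CompleteOrderedField) : Set where
  open CompleteOrderedField R
  field
    mass     : String → ℝ
    mass≥0   : ∀ w → 0# ≤ mass w
    mass≤1   : ∀ w → mass w ≤ 1#
    mass-λ   : mass [] ≡ 1#
    additive : ∀ w → mass w ≡ mass (w ∷ʳ false) + mass (w ∷ʳ true)

module _ {R : CompleteOrderedField} (ν : ProbabilityMeasure R) where
  open CompleteOrderedField R
  open ProbabilityMeasure ν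

  -- The sum of the masses of a possibly infinite set B of strings: as the
  -- terms are nonnegative, it is the supremum of the finite partial sums,
  -- here over repetition-free lists of elements of B.
  PartialSum : Pred String 0ℓ → Pred ℝ 0ℓ
  PartialSum B s =
    Σ[ l ∈ List String ] Unique l × All B l × s ≡ foldr _+_ 0# (map mass l)

  IsSum : Pred String 0ℓ → Pred ℝ 0ℓ
  IsSum B = IsSup (PartialSum B)

  -- "Y is open and has measure m".  Every open set has such a
  -- representation, and m does not depend on the choice of B.
  HasOpenMeasure : Pred Cantor 0ℓ → ℝ → Set (suc 0ℓ)
  HasOpenMeasure Y m =
    Σ[ B ∈ Pred String 0ℓ ] PrefixSet B × Y ≐ Cylinders B × IsSum B m

  OpenCoverMeasure : Pred Cantor 0ℓ → Pred ℝ (suc 0ℓ)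
  OpenCoverMeasure X m = Σ[ Y ∈ Pred Cantor 0ℓ ] X ⊆ Y × HasOpenMeasure Y m

  wholeSpace : ∀ X → OpenCoverMeasure X 1#
  wholeSpace X = Cylinders (_≡ []) , covers , (_≡ []) , prefixSet
               , ((λ A → A) , (λ A → A)) , upper , least
    where
    covers : X ⊆ Cylinders (_≡ [])
    covers _ = [] , refl , refl
    prefixSet : PrefixSet (_≡ [])
    prefixSet refl refl _ = refl
    sum[λ] : mass [] + 0# ≡ 1#
    sum[λ] = trans (+-identityʳ _) mass-λ
    upper : UpperBound (PartialSum (_≡ [])) 1#
    upper _ ([] , _ , _ , refl) = 0≤1
    upper _ ((_ ∷ []) , _ , (refl ∷ []) , refl) = ≤-reflexive sum[λ]
    upper _ ((_ ∷ _ ∷ _) , ((≢ ∷ _) ∷ _) , (refl ∷ refl ∷ _) , _) = contradiction refl ≢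
    least : LowerBound (UpperBound (PartialSum (_≡ []))) 1#
    least u ub = ub 1# (([] ∷ []) , ([] ∷ []) , (refl ∷ []) , sym sum[λ])

  0≤OpenCoverMeasure : ∀ X → LowerBound (OpenCoverMeasure X) 0#
  0≤OpenCoverMeasure X m (_ , _ , _ , _ , _ , ub , _) = ub 0# ([] , [] , [] , refl)

  outerMeasure : Pred Cantor 0ℓ → ℝ
  outerMeasure X = inf (OpenCoverMeasure X) (1# , wholeSpace X) (0# , 0≤OpenCoverMeasure X)

  Measurable : Pred Cantor 0ℓ → Set (suc 0ℓ)
  Measurable X =
    ∀ (Y : Pred Cantor 0ℓ) → outerMeasure Y ≡ outerMeasure (Y ∩ X) + outerMeasure (Y ∖ X)

  measure : (X : Pred Cantor 0ℓ) → Measurable X → ℝ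
  measure X _ = outerMeasure X

  IsMartingale : (String → ℝ) → Set
  IsMartingale d =
    (∀ w → 0# ≤ d w) ×
    (∀ w → d w * mass w ≡ d (w ∷ʳ false) * mass (w ∷ʳ false) + d (w ∷ʳ true) * mass (w ∷ʳ true))

  -- The laws are irrelevant so that, as for sets of functions, two
  -- martingales are equal when their underlying functions are.
  record Martingale : Set where
    constructor martingale
    field
      value         : String → ℝ
      .isMartingale : IsMartingale value

  open Martingale using (value)

  value≥0 : ∀ d w → 0# ≤ value d w
  value≥0 (martingale d isM) w = recompute (0# ≤? d w) (proj₁ isM w)

  fair : ∀ d w → value d w * mass w
               ≡ value d (w ∷ʳ false) * mass (w ∷ʳ false) + value d (w ∷ʳ true) * mass (w ∷ʳ true)
  fair (martingale d isM) w = recompute (_ ≟ _) (proj₂ isM w)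

  𝟏 : Martingale
  𝟏 = martingale (λ _ → 1#) ((λ _ → 0≤1) , fair-𝟏)
    where
    fair-𝟏 : ∀ w → 1# * mass w ≡ 1# * mass (w ∷ʳ false) + 1# * mass (w ∷ʳ true)
    fair-𝟏 w = trans (cong (1# *_) (additive w)) (distribˡ 1# _ _)

  S¹[_] : Martingale → Pred Cantor 0ℓ
  S¹[ d ] A = ∃ λ n → 1# ≤ value d (A ↾ n)

  record SplittingOperator (X⁺ X⁻ : Pred Cantor 0ℓ) (disjoint : X⁺ ⊥ X⁻) : Set where
    field
      Φ : ℕ → Martingale → Martingale × Martingale

    Φ⁺ : ℕ → Martingale → Martingale
    Φ⁺ r d = proj₁ (Φ r d)

    Φ⁻ : ℕ → Martingale → Martingale
    Φ⁻ r d = proj₂ (Φ r d)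

    field
      covers⁺ : ∀ r d → X⁺ ∩ S¹[ d ] ⊆ S¹[ Φ⁺ r d ]
      covers⁻ : ∀ r d → X⁻ ∩ S¹[ d ] ⊆ S¹[ Φ⁻ r d ]
      splits  : ∀ r d → value (Φ⁺ r d) [] + value (Φ⁻ r d) [] ≤ value d [] + 2^- r

  AllMeasurement : Pred Cantor 0ℓ → Set
  AllMeasurement X = SplittingOperator X (∁ X) (λ (x∈X , x∉X) → x∉X x∈X)

  -- A proof of existence is a measurement, so quantifying over proofs of
  -- AllMeasurable X is quantifying over all measurements of X.
  AllMeasurable : Pred Cantor 0ℓ → Set
  AllMeasurable X = AllMeasurement X

  module _ {X : Pred Cantor 0ℓ} (M : AllMeasurement X) where
    open SplittingOperator M

    InitialValue : Pred ℝ (suc 0ℓ)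
    InitialValue x = Lift (suc 0ℓ) (∃ λ r → x ≡ value (Φ⁺ r 𝟏) [])

    Φ⁺∞ : ℝ
    Φ⁺∞ = inf InitialValue (_ , lift (0 , refl))
            (0# , λ { _ (lift (r , refl)) → value≥0 (Φ⁺ r 𝟏) [] })

  allMeasure : (X : Pred Cantor 0ℓ) → AllMeasurable X → ℝ
  allMeasure X M = Φ⁺∞ M

{-# OPTIONS --safe #-}
module Submission where

open import Algebra.Bundles using (CommutativeRing)
import Algebra.Properties.AbelianGroup as AbelianGroupProperties
import Algebra.Properties.CommutativeSemigroup as CommutativeSemigroupProperties
open import Axiom.ExcludedMiddle using (ExcludedMiddle)
open import Axiom.Extensionality.Propositional using (Extensionality)
open import Data.Bool using (Bool; true; false)
import Data.Bool.Properties as Bool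
open import Data.Empty using (⊥-elim)
open import Data.List using (List; []; _∷_; _∷ʳ_; _++_; [_]; map; foldr; length; deduplicate)
open import Data.List.Membership.Propositional using () renaming (_∈_ to _∈ˡ_)
open import Data.List.Membership.Propositional.Properties
  using (∈-∃++; ∈-++⁺ˡ; ∈-++⁺ʳ; ∈-++⁻; ∈-deduplicate⁺)
open import Data.List.Properties using (≡-dec; applyUpTo-∷ʳ)
open import Data.List.Relation.Binary.Prefix.Heterogeneous using (Prefix; []; _∷_)
open import Data.List.Relation.Unary.All as All using (All; []; _∷_)
import Data.List.Relation.Unary.All.Properties as All
open import Data.List.Relation.Unary.AllPairs using ([]; _∷_)
open import Data.List.Relation.Unary.Any using (here; there)
open import Data.List.Relation.Unary.Unique.Propositional using (Unique)
import Data.List.Relation.Unary.Unique.DecPropositional.Properties as DecUnique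
open import Data.Nat using (ℕ; zero) renaming (suc to 1+_)
open import Data.Product using (Σ-syntax; ∃; _×_; _,_; proj₁; proj₂)
open import Data.Sum as Sum using (inj₁; inj₂)
open import Function using (_∘_)
open import Function.Bundles using (_⇔_; mk⇔)
open import Level using (0ℓ; suc; Lift; lift; lower)
open import Relation.Binary.Bundles using (DecTotalOrder)
open import Relation.Binary.PropositionalEquality
  using (_≡_; _≢_; refl; sym; trans; cong; cong₂; subst; module ≡-Reasoning)
import Relation.Binary.Reasoning.PartialOrder as PartialOrderReasoning
open import Relation.Nullary using (Dec; yes; no; ¬_; contradiction)
open import Relation.Nullary.Decidable using (map′; decidable-stable)
open import Relation.Unary using (Pred; _∈_; _⊆_; _∩_; _∖_; _∪_; U; Satisfiable)
open import Defs

-- The outer measure of X is the infimum of the initial values of the martingales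
-- d with X ⊆ S¹[d].  Indeed S¹[d] is the union of the cylinders of the minimal
-- strings w with d(w) ≥ 1, whose measure is at most d(λ) by Kraft's inequality for
-- d·ν; conversely an open set Y is contained in S¹[d] for d(w) = ν(Y ∩ C_w) / ν(w),
-- which has initial value ν(Y).  A measurement applied to such a d thus splits any
-- cover of a set into covers of its parts inside and outside X, and conversely
-- near-optimal covers of X ∩ S¹[d] and S¹[d] ∖ X are a measurement.

-- Arithmetic of a complete ordered field.

module OrderedField (R : CompleteOrderedField) where
  open CompleteOrderedField R
  open CommutativeRing commutativeRing public
    using (+-comm; +-assoc; +-identityˡ; -‿inverseʳ; *-comm; *-assoc; *-identityˡ; *-identityʳ;
           distribʳ; zeroˡ; +-commutativeSemigroup)
  open CommutativeSemigroupProperties +-commutativeSemigroup public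
    using () renaming (interchange to +-interchange; x∙yz≈y∙xz to x+[y+z]≡y+[x+z])
  open AbelianGroupProperties +-abelianGroup public using () renaming (⁻¹-∙-comm to -‿+-comm)

  ≤-decTotalOrder : DecTotalOrder 0ℓ 0ℓ 0ℓ
  ≤-decTotalOrder = record { isDecTotalOrder = isDecTotalOrder }

  open DecTotalOrder ≤-decTotalOrder using (poset)

  module ≤-Reasoning = PartialOrderReasoning poset

  +-monoˡ-≤ : ∀ x {y z} → y ≤ z → y + x ≤ z + x
  +-monoˡ-≤ x {y} {z} y≤z = begin
    y + x  ≡⟨ +-comm y x ⟩
    x + y  ≤⟨ +-monoʳ-≤ x y≤z ⟩
    x + z  ≡⟨ +-comm x z ⟩
    z + x  ∎
    where open ≤-Reasoning

  +-mono-≤ : ∀ {w x y z} → w ≤ x → y ≤ z → w + y ≤ x + z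
  +-mono-≤ {x = x} {y} w≤x y≤z = ≤-trans (+-monoˡ-≤ y w≤x) (+-monoʳ-≤ x y≤z)

  +-nonneg : ∀ {x y} → 0# ≤ x → 0# ≤ y → 0# ≤ x + y
  +-nonneg {x} {y} 0≤x 0≤y = subst (_≤ x + y) (+-identityʳ 0#) (+-mono-≤ 0≤x 0≤y)

  x≤x+y : ∀ {x y} → 0# ≤ y → x ≤ x + y
  x≤x+y {x} {y} 0≤y = subst (_≤ x + y) (+-identityʳ x) (+-monoʳ-≤ x 0≤y)

  y≤x+y : ∀ {x y} → 0# ≤ x → y ≤ x + y
  y≤x+y {x} {y} 0≤x = subst (_≤ x + y) (+-identityˡ y) (+-monoˡ-≤ y 0≤x)

  [x-y]+y≡x : ∀ x y → (x + - y) + y ≡ x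
  [x-y]+y≡x x y = begin
    (x + - y) + y  ≡⟨ +-assoc x (- y) y ⟩
    x + (- y + y)  ≡⟨ cong (x +_) (-‿inverseˡ y) ⟩
    x + 0#         ≡⟨ +-identityʳ x ⟩
    x              ∎
    where open ≡-Reasoning

  [x+y]-y≡x : ∀ x y → (x + y) + - y ≡ x
  [x+y]-y≡x x y = begin
    (x + y) + - y  ≡⟨ +-assoc x y (- y) ⟩
    x + (y + - y)  ≡⟨ cong (x +_) (-‿inverseʳ y) ⟩
    x + 0#         ≡⟨ +-identityʳ x ⟩
    x              ∎
    where open ≡-Reasoning

  x+y≤z⇒x≤z-y : ∀ {x y z} → x + y ≤ z → x ≤ z + - y
  x+y≤z⇒x≤z-y {x} {y} {z} le = subst (_≤ z + - y) ([x+y]-y≡x x y) (+-monoˡ-≤ (- y) le)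

  x≤z-y⇒x+y≤z : ∀ {x y z} → x ≤ z + - y → x + y ≤ z
  x≤z-y⇒x+y≤z {x} {y} {z} le = subst (x + y ≤_) ([x-y]+y≡x z y) (+-monoˡ-≤ y le)

  x-y≤z⇒x≤z+y : ∀ {x y z} → x + - y ≤ z → x ≤ z + y
  x-y≤z⇒x≤z+y {x} {y} {z} le = subst (_≤ z + y) ([x-y]+y≡x x y) (+-monoˡ-≤ y le)

  x≤z+y⇒x-y≤z : ∀ {x y z} → x ≤ z + y → x + - y ≤ z
  x≤z+y⇒x-y≤z {x} {y} {z} le = subst (x + - y ≤_) ([x+y]-y≡x z y) (+-monoˡ-≤ (- y) le)

  +-cancelʳ-≤ : ∀ {x y} z → x + z ≤ y + z → x ≤ y
  +-cancelʳ-≤ {x} {y} z le = subst (x ≤_) ([x+y]-y≡x y z) (x+y≤z⇒x≤z-y le)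

  x≤y⇒0≤y-x : ∀ {x y} → x ≤ y → 0# ≤ y + - x
  x≤y⇒0≤y-x {x} {y} x≤y = x+y≤z⇒x≤z-y (subst (_≤ y) (sym (+-identityˡ x)) x≤y)

  x+y≤x⇒y≤0 : ∀ {x y} → x + y ≤ x → y ≤ 0#
  x+y≤x⇒y≤0 {x} {y} le = +-cancelʳ-≤ x (begin
    y + x   ≡⟨ +-comm y x ⟩
    x + y   ≤⟨ le ⟩
    x       ≡⟨ +-identityˡ x ⟨
    0# + x  ∎)
    where open ≤-Reasoning

  *-monoʳ-≤ : ∀ {x y z} → 0# ≤ z → x ≤ y → x * z ≤ y * z
  *-monoʳ-≤ {x} {y} {z} 0≤z x≤y = begin
    x * z                        ≤⟨ y≤x+y (*-nonneg (x≤y⇒0≤y-x x≤y) 0≤z) ⟩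
    (y + - x) * z + x * z        ≡⟨ distribʳ z (y + - x) x ⟨
    ((y + - x) + x) * z          ≡⟨ cong (_* z) ([x-y]+y≡x y x) ⟩
    y * z                        ∎
    where open ≤-Reasoning

  1≰0 : ¬ 1# ≤ 0#
  1≰0 1≤0 = 0≢1 (≤-antisym 0≤1 1≤0)

  ⁻¹-nonneg : ∀ {x} → 0# ≤ x → x ≢ 0# → 0# ≤ x ⁻¹
  ⁻¹-nonneg {x} 0≤x x≢0 with total 0# (x ⁻¹)
  ... | inj₁ 0≤x⁻¹ = 0≤x⁻¹
  ... | inj₂ x⁻¹≤0 = contradiction 1≤0 1≰0
    where
    open ≤-Reasoning
    1≤0 : 1# ≤ 0#
    1≤0 = begin
      1#            ≡⟨ ⁻¹-inverseʳ x x≢0 ⟨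
      x * x ⁻¹      ≡⟨ *-comm x (x ⁻¹) ⟩
      x ⁻¹ * x      ≤⟨ *-monoʳ-≤ 0≤x x⁻¹≤0 ⟩
      0# * x        ≡⟨ zeroˡ x ⟩
      0#            ∎

  1+1≢0 : 1# + 1# ≢ 0#
  1+1≢0 eq = 1≰0 (subst (1# ≤_) eq (x≤x+y 0≤1))

  2^--halves : ∀ r → 2^- (1+ r) + 2^- (1+ r) ≡ 2^- r
  2^--halves r = begin
    ½ * 2^- r + ½ * 2^- r      ≡⟨ distribʳ (2^- r) ½ ½ ⟨
    (½ + ½) * 2^- r            ≡⟨ cong (_* 2^- r) (cong₂ _+_ (*-identityˡ ½) (*-identityˡ ½)) ⟨
    (1# * ½ + 1# * ½) * 2^- r  ≡⟨ cong (_* 2^- r) (distribʳ ½ 1# 1#) ⟨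
    ((1# + 1#) * ½) * 2^- r    ≡⟨ cong (_* 2^- r) (⁻¹-inverseʳ (1# + 1#) 1+1≢0) ⟩
    1# * 2^- r                 ≡⟨ *-identityˡ (2^- r) ⟩
    2^- r                      ∎
    where
    open ≡-Reasoning
    ½ : ℝ
    ½ = (1# + 1#) ⁻¹

  2^-≰0 : ∀ r → ¬ 2^- r ≤ 0#
  2^-≰0 zero      le = 1≰0 le
  2^-≰0 (1+ r) le = 2^-≰0 r (begin
    2^- r                    ≡⟨ 2^--halves r ⟨
    2^- (1+ r) + 2^- (1+ r)  ≤⟨ +-mono-≤ le le ⟩
    0# + 0#                  ≡⟨ +-identityʳ 0# ⟩
    0#                       ∎)
    where open ≤-Reasoning

  -- The infimum i of the 2^-r satisfies i + i ≤ i, because twice it is again a lower bound.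
  ≤+2^-⇒≤ : ∀ {x y} → (∀ r → x ≤ y + 2^- r) → x ≤ y
  ≤+2^-⇒≤ {x} {y} x≤ = subst (x ≤_) (+-identityˡ y) (x-y≤z⇒x≤z+y x-y≤0)
    where
    open ≤-Reasoning
    Powers : Pred ℝ (suc 0ℓ)
    Powers z = Lift (suc 0ℓ) (∃ λ r → z ≡ 2^- r)
    x-y-lower : LowerBound Powers (x + - y)
    x-y-lower _ (lift (r , refl)) = x≤z+y⇒x-y≤z (subst (x ≤_) (+-comm y (2^- r)) (x≤ r))
    isInf : ∃ (IsInf Powers)
    isInf = inf-complete Powers (_ , lift (0 , refl)) (_ , x-y-lower)
    i : ℝ
    i = proj₁ isInf
    i≤2^- : ∀ r → i ≤ 2^- r
    i≤2^- r = proj₁ (proj₂ isInf) _ (lift (r , refl))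
    i+i≤i : i + i ≤ i
    i+i≤i = proj₂ (proj₂ isInf) (i + i) λ { _ (lift (r , refl)) →
      subst (i + i ≤_) (2^--halves r) (+-mono-≤ (i≤2^- (1+ r)) (i≤2^- (1+ r))) }
    x-y≤0 : x + - y ≤ 0#
    x-y≤0 = ≤-trans (proj₂ (proj₂ isInf) _ x-y-lower) (x+y≤x⇒y≤0 i+i≤i)

  -- Completeness is postulated one level up, whereas sums over sets of strings are suprema of small
  -- predicates; lifting bridges the gap.
  sup-complete₀ : (P : Pred ℝ 0ℓ) → Satisfiable P → Satisfiable (UpperBound P) → ∃ (IsSup P)
  sup-complete₀ P (p , Pp) (u , ub)
    with s , s-ub , s-least ← sup-complete (Lift (suc 0ℓ) ∘ P) (p , lift Pp) (u , λ x → ub x ∘ lower)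
    = s , (λ x → s-ub x ∘ lift) , (λ v v-ub → s-least v (λ x → v-ub x ∘ lower))

  -- Finite sums over lists.

  ∑ : {A : Set} → List A → (A → ℝ) → ℝ
  ∑ l f = foldr _+_ 0# (map f l)

  ∑-nonneg : ∀ {A : Set} (l : List A) {f : A → ℝ} → (∀ v → 0# ≤ f v) → 0# ≤ ∑ l f
  ∑-nonneg []      0≤f = ≤-refl
  ∑-nonneg (v ∷ l) 0≤f = +-nonneg (0≤f v) (∑-nonneg l 0≤f)

  ∑-nonpos : ∀ {A : Set} (l : List A) {f : A → ℝ} → (∀ v → f v ≤ 0#) → ∑ l f ≤ 0#
  ∑-nonpos []      f≤0 = ≤-refl
  ∑-nonpos (v ∷ l) {f} f≤0 =
    subst (f v + ∑ l f ≤_) (+-identityʳ 0#) (+-mono-≤ (f≤0 v) (∑-nonpos l f≤0))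

  ∑-mono-≤ : ∀ {A : Set} {l : List A} {f g : A → ℝ} → All (λ v → f v ≤ g v) l → ∑ l f ≤ ∑ l g
  ∑-mono-≤ []           = ≤-refl
  ∑-mono-≤ (f≤g ∷ fs≤gs) = +-mono-≤ f≤g (∑-mono-≤ fs≤gs)

  ∑-cong : ∀ {A : Set} {l : List A} {f g : A → ℝ} → All (λ v → f v ≡ g v) l → ∑ l f ≡ ∑ l g
  ∑-cong []            = refl
  ∑-cong (f≡g ∷ fs≡gs) = cong₂ _+_ f≡g (∑-cong fs≡gs)

  ∑-distrib-+ : ∀ {A : Set} (l : List A) (f g : A → ℝ) → ∑ l (λ v → f v + g v) ≡ ∑ l f + ∑ l g
  ∑-distrib-+ []      f g = sym (+-identityʳ 0#)
  ∑-distrib-+ (v ∷ l) f g =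
    trans (cong (_ +_) (∑-distrib-+ l f g)) (+-interchange (f v) (g v) (∑ l f) (∑ l g))

  ∑-middle : ∀ {A : Set} (ys : List A) v zs (f : A → ℝ) → ∑ (ys ++ v ∷ zs) f ≡ f v + ∑ (ys ++ zs) f
  ∑-middle []       v zs f = refl
  ∑-middle (y ∷ ys) v zs f =
    trans (cong (f y +_) (∑-middle ys v zs f)) (x+[y+z]≡y+[x+z] (f y) (f v) _)

  -- Once `v` is cut out of `m`, the later entries of `l`, all different from `v`, are still found
  -- in what remains; so each entry of `l` uses up its own entry of `m`.
  ∑-⊆ : ∀ {A : Set} {l m : List A} {f : A → ℝ} → (∀ v → 0# ≤ f v) →
        Unique l → (∀ {v} → v ∈ˡ l → v ∈ˡ m) → ∑ l f ≤ ∑ m f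
  ∑-⊆ {l = []}    {m} 0≤f _            _   = ∑-nonneg m 0≤f
  ∑-⊆ {l = v ∷ l} {f = f} 0≤f (v∉l ∷ l!) l⊆m with ys , zs , refl ← ∈-∃++ (l⊆m (here refl)) = begin
    f v + ∑ l f           ≤⟨ +-monoʳ-≤ (f v) (∑-⊆ 0≤f l! l⊆ys++zs) ⟩
    f v + ∑ (ys ++ zs) f  ≡⟨ ∑-middle ys v zs f ⟨
    ∑ (ys ++ v ∷ zs) f    ∎
    where
    open ≤-Reasoning
    l⊆ys++zs : ∀ {u} → u ∈ˡ l → u ∈ˡ ys ++ zs
    l⊆ys++zs u∈l with ∈-++⁻ ys (l⊆m (there u∈l))
    ... | inj₁ u∈ys         = ∈-++⁺ˡ u∈ys
    ... | inj₂ (here refl)  = contradiction refl (All.lookup v∉l u∈l)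
    ... | inj₂ (there u∈zs) = ∈-++⁺ʳ ys u∈zs

-- Prefixes and minimal strings.

Prefix-↾ : ∀ {u} (A : Cantor) n → Prefix _≡_ u (A ↾ n) → A ∈ Cylinder u
Prefix-↾ A zero   []           = refl
Prefix-↾ A (1+ n) []           = refl
Prefix-↾ A (1+ n) (refl ∷ u⊑A) = cong (A 0 ∷_) (Prefix-↾ (A ∘ 1+_) n u⊑A)

Minimal : Pred String 0ℓ → Pred String 0ℓ
Minimal P w = P w × (∀ {u} → P u → Prefix _≡_ u w → u ≡ w)

Minimal-prefixSet : ∀ P → PrefixSet (Minimal P)
Minimal-prefixSet P (Pu , _) (_ , min) = min Pu

-- Reading `w` from the left, the first prefix found in `P` is minimal. The recursion tests the
-- empty string and otherwise passes to the strings behind the first bit; the failed test rules out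
-- the empty string as a smaller competitor.
minimal-prefix : ∀ {P : Pred String 0ℓ} → (∀ w → Dec (P w)) → ∀ w → P w →
                 ∃ λ u → u ∈ Minimal P × Prefix _≡_ u w
minimal-prefix P? w Pw with P? []
... | yes P[] = [] , (P[] , λ { _ [] → refl }) , []
minimal-prefix P? []      P[] | no ¬P[] = contradiction P[] ¬P[]
minimal-prefix {P} P? (a ∷ w) Paw | no ¬P[]
  with u , (Pau , min) , u⊑w ← minimal-prefix {P ∘ (a ∷_)} (P? ∘ (a ∷_)) w Paw
  = a ∷ u , (Pau , λ { Pv [] → contradiction Pv ¬P[]
                     ; Pv (refl ∷ v⊑u) → cong (a ∷_) (min Pv v⊑u) }) , refl ∷ u⊑w

-- Finite measures on the Cantor space, given by their values on cylinders.

module FiniteMeasures (R : CompleteOrderedField) where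
  open CompleteOrderedField R
  open OrderedField R

  -- The total mass `μ []` is not normalised, so restrictions, differences and the capital of a
  -- martingale are all instances.
  record IsMeasure (μ : String → ℝ) : Set where
    field
      nonneg   : ∀ w → 0# ≤ μ w
      additive : ∀ w → μ w ≡ μ (w ∷ʳ false) + μ (w ∷ʳ true)

  open IsMeasure public

  -- The part of the measure inside one half of the space; it carries the recursions on strings
  -- below.
  tail-isMeasure : ∀ {μ} a → IsMeasure μ → IsMeasure (μ ∘ (a ∷_))
  tail-isMeasure a isμ .nonneg   = isμ .nonneg ∘ (a ∷_)
  tail-isMeasure a isμ .additive = isμ .additive ∘ (a ∷_)

  μ[a]≤μ[] : ∀ {μ} → IsMeasure μ → ∀ a → μ [ a ] ≤ μ []
  μ[a]≤μ[] {μ} isμ false = subst (μ [ false ] ≤_) (sym (isμ .additive [])) (x≤x+y (isμ .nonneg _))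
  μ[a]≤μ[] {μ} isμ true  = subst (μ [ true ] ≤_) (sym (isμ .additive [])) (y≤x+y (isμ .nonneg _))

  μw≤μ[] : ∀ {μ} → IsMeasure μ → ∀ w → μ w ≤ μ []
  μw≤μ[] isμ []      = ≤-refl
  μw≤μ[] isμ (a ∷ w) = ≤-trans (μw≤μ[] (tail-isMeasure a isμ) w) (μ[a]≤μ[] isμ a)

  -- restrict μ v w is the measure of C_v ∩ C_w.
  restrict : (String → ℝ) → String → String → ℝ
  restrict μ []          w           = μ w
  restrict μ (a ∷ v)     []          = μ (a ∷ v)
  restrict μ (false ∷ v) (false ∷ w) = restrict (μ ∘ (false ∷_)) v w
  restrict μ (true ∷ v)  (true ∷ w)  = restrict (μ ∘ (true ∷_)) v w
  restrict μ (false ∷ v) (true ∷ w)  = 0#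
  restrict μ (true ∷ v)  (false ∷ w) = 0#

  restrict-[] : ∀ μ v → restrict μ v [] ≡ μ v
  restrict-[] μ []      = refl
  restrict-[] μ (a ∷ v) = refl

  restrict-diag : ∀ μ v → restrict μ v v ≡ μ v
  restrict-diag μ []          = refl
  restrict-diag μ (false ∷ v) = restrict-diag (μ ∘ (false ∷_)) v
  restrict-diag μ (true ∷ v)  = restrict-diag (μ ∘ (true ∷_)) v

  restrict-nonneg : ∀ {μ} → IsMeasure μ → ∀ v w → 0# ≤ restrict μ v w
  restrict-nonneg isμ []          w           = isμ .nonneg w
  restrict-nonneg isμ (a ∷ v)     []          = isμ .nonneg (a ∷ v)
  restrict-nonneg isμ (false ∷ v) (false ∷ w) = restrict-nonneg (tail-isMeasure false isμ) v w
  restrict-nonneg isμ (true ∷ v)  (true ∷ w)  = restrict-nonneg (tail-isMeasure true isμ) v w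
  restrict-nonneg isμ (false ∷ v) (true ∷ w)  = ≤-refl
  restrict-nonneg isμ (true ∷ v)  (false ∷ w) = ≤-refl

  -- The recursion turns around where `w` is empty and `v` is not: `C_v` then lies in one half of
  -- the space, and the other half contributes 0.
  restrict-additive : ∀ {μ} → IsMeasure μ → ∀ v w →
    restrict μ v w ≡ restrict μ v (w ∷ʳ false) + restrict μ v (w ∷ʳ true)
  restrict-additive isμ []          w           = isμ .additive w
  restrict-additive isμ (false ∷ v) []          =
    sym (trans (+-identityʳ _) (restrict-[] _ v))
  restrict-additive isμ (true ∷ v)  []          =
    sym (trans (+-identityˡ _) (restrict-[] _ v))
  restrict-additive isμ (false ∷ v) (false ∷ w) = restrict-additive (tail-isMeasure false isμ) v w
  restrict-additive isμ (true ∷ v)  (true ∷ w)  = restrict-additive (tail-isMeasure true isμ) v w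
  restrict-additive isμ (false ∷ v) (true ∷ w)  = sym (+-identityʳ 0#)
  restrict-additive isμ (true ∷ v)  (false ∷ w) = sym (+-identityʳ 0#)

  restrict-isMeasure : ∀ {μ} → IsMeasure μ → ∀ v → IsMeasure (restrict μ v)
  restrict-isMeasure isμ v .nonneg   = restrict-nonneg isμ v
  restrict-isMeasure isμ v .additive = restrict-additive isμ v

  restrict≤ : ∀ {μ} → IsMeasure μ → ∀ v w → restrict μ v w ≤ μ w
  restrict≤ isμ []          w           = ≤-refl
  restrict≤ isμ (a ∷ v)     []          = μw≤μ[] isμ (a ∷ v)
  restrict≤ isμ (false ∷ v) (false ∷ w) = restrict≤ (tail-isMeasure false isμ) v w
  restrict≤ isμ (true ∷ v)  (true ∷ w)  = restrict≤ (tail-isMeasure true isμ) v w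
  restrict≤ isμ (false ∷ v) (true ∷ w)  = isμ .nonneg (true ∷ w)
  restrict≤ isμ (true ∷ v)  (false ∷ w) = isμ .nonneg (false ∷ w)

  restrict-incomparable : ∀ μ v w → ¬ Prefix _≡_ v w → ¬ Prefix _≡_ w v → restrict μ v w ≡ 0#
  restrict-incomparable μ []          w           v⋢w w⋢v = contradiction [] v⋢w
  restrict-incomparable μ (a ∷ v)     []          v⋢w w⋢v = contradiction [] w⋢v
  restrict-incomparable μ (false ∷ v) (false ∷ w) v⋢w w⋢v =
    restrict-incomparable _ v w (v⋢w ∘ (refl ∷_)) (w⋢v ∘ (refl ∷_))
  restrict-incomparable μ (true ∷ v)  (true ∷ w)  v⋢w w⋢v =
    restrict-incomparable _ v w (v⋢w ∘ (refl ∷_)) (w⋢v ∘ (refl ∷_))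
  restrict-incomparable μ (false ∷ v) (true ∷ w)  v⋢w w⋢v = refl
  restrict-incomparable μ (true ∷ v)  (false ∷ w) v⋢w w⋢v = refl

  _−_ : (String → ℝ) → (String → ℝ) → String → ℝ
  (μ − ρ) w = μ w + - ρ w

  −-isMeasure : ∀ {μ ρ} → IsMeasure μ → IsMeasure ρ → (∀ w → ρ w ≤ μ w) → IsMeasure (μ − ρ)
  −-isMeasure isμ isρ ρ≤μ .nonneg   w = x≤y⇒0≤y-x (ρ≤μ w)
  −-isMeasure {μ} {ρ} isμ isρ ρ≤μ .additive w = begin
    μ w + - ρ w
      ≡⟨ cong₂ (λ x y → x + - y) (isμ .additive w) (isρ .additive w) ⟩
    (μ w₀ + μ w₁) + - (ρ w₀ + ρ w₁)
      ≡⟨ cong ((μ w₀ + μ w₁) +_) (-‿+-comm (ρ w₀) (ρ w₁)) ⟨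
    (μ w₀ + μ w₁) + (- ρ w₀ + - ρ w₁)
      ≡⟨ +-interchange (μ w₀) (μ w₁) (- ρ w₀) (- ρ w₁) ⟩
    (μ w₀ + - ρ w₀) + (μ w₁ + - ρ w₁)
      ∎
    where
    open ≡-Reasoning
    w₀ w₁ : String
    w₀ = w ∷ʳ false
    w₁ = w ∷ʳ true

  -- Removing C_v from the measure leaves it unchanged on the other strings of
  -- a prefix set containing v.
  kraft : ∀ {μ} {B : Pred String 0ℓ} → IsMeasure μ → PrefixSet B →
          ∀ {l} → Unique l → All B l → ∑ l μ ≤ μ []
  kraft isμ prefixSet []         []        = isμ .nonneg []
  kraft {μ} {B} isμ prefixSet {v ∷ l} (v∉l ∷ l!) (Bv ∷ Bl) = begin
    μ v + ∑ l μ                      ≡⟨ cong (μ v +_) (∑-cong (All.zipWith unchanged (v∉l , Bl))) ⟩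
    μ v + ∑ l (μ − restrict μ v)     ≤⟨ +-monoʳ-≤ (μ v) (kraft isμ′ prefixSet l! Bl) ⟩
    μ v + (μ [] + - restrict μ v []) ≡⟨ cong (λ x → μ v + (μ [] + - x)) (restrict-[] μ v) ⟩
    μ v + (μ [] + - μ v)             ≡⟨ +-comm (μ v) _ ⟩
    (μ [] + - μ v) + μ v             ≡⟨ [x-y]+y≡x (μ []) (μ v) ⟩
    μ []                             ∎
    where
    open ≤-Reasoning
    isμ′ : IsMeasure (μ − restrict μ v)
    isμ′ = −-isMeasure isμ (restrict-isMeasure isμ v) (restrict≤ isμ v)
    unchanged : ∀ {u} → v ≢ u × B u → μ u ≡ (μ − restrict μ v) u
    unchanged {u} (v≢u , Bu) = begin-equality
      μ u                     ≡⟨ [x+y]-y≡x (μ u) 0# ⟨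
      (μ u + 0#) + - 0#       ≡⟨ cong₂ (λ x y → x + - y) (+-identityʳ (μ u)) (sym disjoint) ⟩
      μ u + - restrict μ v u  ∎
      where
      disjoint : restrict μ v u ≡ 0#
      disjoint = restrict-incomparable μ v u (v≢u ∘ prefixSet Bv Bu) (v≢u ∘ sym ∘ prefixSet Bu Bv)

  ∑-isMeasure : ∀ {A : Set} (l : List A) {f : A → String → ℝ} → (∀ v → IsMeasure (f v)) →
                IsMeasure (λ w → ∑ l (λ v → f v w))
  ∑-isMeasure l isμ .nonneg   w = ∑-nonneg l (λ v → isμ v .nonneg w)
  ∑-isMeasure l {f} isμ .additive w =
    trans (∑-cong (All.universal (λ v → isμ v .additive w) l))
          (∑-distrib-+ l (λ v → f v (w ∷ʳ false)) (λ v → f v (w ∷ʳ true)))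

  -- The measure of C_B ∩ C_w as a function of w: the supremum of a directed family of measures.
  module OpenSetMeasure {μ : String → ℝ} (isμ : IsMeasure μ) (B : Pred String 0ℓ)
    {m : ℝ} (bound : ∀ l → Unique l → All B l → ∑ l μ ≤ m) where

    partial : List String → String → ℝ
    partial l w = ∑ l (λ v → restrict μ v w)

    partial-isMeasure : ∀ l → IsMeasure (partial l)
    partial-isMeasure l = ∑-isMeasure l (restrict-isMeasure isμ)

    Partial : String → Pred ℝ 0ℓ
    Partial w s = Σ[ l ∈ List String ] Unique l × All B l × s ≡ partial l w

    partial≤bound : ∀ w → UpperBound (Partial w) m
    partial≤bound w _ (l , l! , Bl , refl) = begin
      partial l w   ≤⟨ μw≤μ[] (partial-isMeasure l) w ⟩
      partial l []  ≡⟨ ∑-cong (All.universal (restrict-[] μ) l) ⟩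
      ∑ l μ         ≤⟨ bound l l! Bl ⟩
      m             ∎
      where open ≤-Reasoning

    supremum : ∀ w → ∃ (IsSup (Partial w))
    supremum w = sup-complete₀ (Partial w) (_ , [] , [] , [] , refl) (m , partial≤bound w)

    total-measure : String → ℝ
    total-measure w = proj₁ (supremum w)

    partial≤total : ∀ {l} → Unique l → All B l → ∀ w → partial l w ≤ total-measure w
    partial≤total l! Bl w = proj₁ (proj₂ (supremum w)) _ (_ , l! , Bl , refl)

    total≤ : ∀ w {u} → (∀ {l} → Unique l → All B l → partial l w ≤ u) → total-measure w ≤ u
    total≤ w ≤u = proj₂ (proj₂ (supremum w)) _ λ { _ (_ , l! , Bl , refl) → ≤u l! Bl }

    -- Merging the two lists and dropping duplicates keeps every entry of each, and the restrictions
    -- are nonnegative, so `∑-⊆` applies twice.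
    partial-directed : ∀ {k l} → Unique k → All B k → Unique l → All B l →
      ∃ λ j → Unique j × All B j ×
              (∀ w → partial k w ≤ partial j w) × (∀ w → partial l w ≤ partial j w)
    partial-directed {k} {l} k! Bk l! Bl =
      deduplicate _≟ₛ_ (k ++ l) , DecUnique.deduplicate-! _≟ₛ_ (k ++ l) ,
      All.deduplicate⁺ _≟ₛ_ (All.++⁺ Bk Bl) ,
      (λ w → ∑-⊆ (λ v → restrict-nonneg isμ v w) k! (∈-deduplicate⁺ _≟ₛ_ ∘ ∈-++⁺ˡ)) ,
      (λ w → ∑-⊆ (λ v → restrict-nonneg isμ v w) l! (∈-deduplicate⁺ _≟ₛ_ ∘ ∈-++⁺ʳ k))
      where
      _≟ₛ_ : (u v : String) → Dec (u ≡ v)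
      _≟ₛ_ = ≡-dec Bool._≟_

    -- One inequality is the additivity of each partial sum. In the other, the suprema at the two
    -- children come from unrelated lists, which directedness replaces by a common one.
    total-isMeasure : IsMeasure total-measure
    total-isMeasure .nonneg   w = partial≤total [] [] w
    total-isMeasure .additive w = ≤-antisym
      (total≤ w λ {l} l! Bl → begin
        partial l w                        ≡⟨ partial-isMeasure l .additive w ⟩
        partial l w₀ + partial l w₁
          ≤⟨ +-mono-≤ (partial≤total l! Bl w₀) (partial≤total l! Bl w₁) ⟩
        total-measure w₀ + total-measure w₁ ∎)
      -- The two suprema are bounded one after the other, each time with the other summand moved to
      -- the right: first `k` varies, then `l` with `k` fixed.
      (x≤z-y⇒x+y≤z (total≤ w₀ λ {k} k! Bk → x+y≤z⇒x≤z-y (begin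
        partial k w₀ + total-measure w₁    ≡⟨ +-comm (partial k w₀) _ ⟩
        total-measure w₁ + partial k w₀
          ≤⟨ x≤z-y⇒x+y≤z (total≤ w₁ λ l! Bl → x+y≤z⇒x≤z-y (joint k! Bk l! Bl)) ⟩
        total-measure w                    ∎)))
      where
      open ≤-Reasoning
      w₀ w₁ : String
      w₀ = w ∷ʳ false
      w₁ = w ∷ʳ true
      joint : ∀ {k l} → Unique k → All B k → Unique l → All B l →
              partial l w₁ + partial k w₀ ≤ total-measure w
      joint {k} {l} k! Bk l! Bl with j , j! , Bj , k≤j , l≤j ← partial-directed k! Bk l! Bl = begin
        partial l w₁ + partial k w₀  ≡⟨ +-comm (partial l w₁) _ ⟩
        partial k w₀ + partial l w₁  ≤⟨ +-mono-≤ (k≤j w₀) (l≤j w₁) ⟩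
        partial j w₀ + partial j w₁  ≡⟨ partial-isMeasure j .additive w ⟨
        partial j w                  ≤⟨ partial≤total j! Bj w ⟩
        total-measure w              ∎

    total≤bound : ∀ w → total-measure w ≤ m
    total≤bound w = total≤ w λ l! Bl → partial≤bound w _ (_ , l! , Bl , refl)

    μ≤total : ∀ {w} → B w → μ w ≤ total-measure w
    μ≤total {w} Bw = begin
      μ w                    ≡⟨ restrict-diag μ w ⟨
      restrict μ w w         ≡⟨ +-identityʳ _ ⟨
      partial [ w ] w        ≤⟨ partial≤total ([] ∷ []) (Bw ∷ []) w ⟩
      total-measure w        ∎
      where open ≤-Reasoning

    -- Absolute continuity with respect to `μ`: every restriction is dominated by `μ`. This is what
    -- lets the total measure have a density.
    total-null : ∀ w → μ w ≡ 0# → total-measure w ≡ 0#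
    total-null w μw≡0 = ≤-antisym
      (total≤ w λ {l} _ _ → ∑-nonpos l (λ v → subst (restrict μ v w ≤_) μw≡0 (restrict≤ isμ v w)))
      (total-isMeasure .nonneg w)

-- Martingales and outer measure.

module OuterMeasure (em : ExcludedMiddle (suc 0ℓ))
  (R : CompleteOrderedField) (ν : ProbabilityMeasure R) where
  open CompleteOrderedField R
  open OrderedField R
  open FiniteMeasures R
  open ProbabilityMeasure ν renaming (additive to mass-additive)
  open Martingale using (value)

  em₀ : {P : Set} → Dec P
  em₀ = map′ lower lift em

  S¹ : Martingale ν → Pred Cantor 0ℓ
  S¹ = S¹[_] ν

  outer : Pred Cantor 0ℓ → ℝ
  outer = outerMeasure ν

  mass-isMeasure : IsMeasure mass
  mass-isMeasure .nonneg   = mass≥0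
  mass-isMeasure .additive = mass-additive

  x*mass[]≡x : ∀ x → x * mass [] ≡ x
  x*mass[]≡x x = trans (cong (x *_) mass-λ) (*-identityʳ x)

  -- The value 1 on null strings makes 1≤density hold there too.
  density : (String → ℝ) → String → ℝ
  density μ w with mass w ≟ 0#
  ... | yes _ = 1#
  ... | no  _ = μ w * mass w ⁻¹

  density-nonneg : ∀ {μ} → IsMeasure μ → ∀ w → 0# ≤ density μ w
  density-nonneg isμ w with mass w ≟ 0#
  ... | yes _ = 0≤1
  ... | no ≢0 = *-nonneg (isμ .nonneg w) (⁻¹-nonneg (mass≥0 w) ≢0)

  density*mass : ∀ μ w → (mass w ≡ 0# → μ w ≡ 0#) → density μ w * mass w ≡ μ w
  density*mass μ w null with mass w ≟ 0#
  -- On a null string the default 1 is multiplied by 0, and `null` makes `μ w` vanish as well.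
  ... | yes ≡0 = trans (*-identityˡ _) (trans ≡0 (sym (null ≡0)))
  ... | no  ≢0 = begin
    μ w * mass w ⁻¹ * mass w    ≡⟨ *-assoc (μ w) (mass w ⁻¹) (mass w) ⟩
    μ w * (mass w ⁻¹ * mass w)  ≡⟨ cong (μ w *_) (*-comm (mass w ⁻¹) (mass w)) ⟩
    μ w * (mass w * mass w ⁻¹)  ≡⟨ cong (μ w *_) (⁻¹-inverseʳ (mass w) ≢0) ⟩
    μ w * 1#                    ≡⟨ *-identityʳ (μ w) ⟩
    μ w                         ∎
    where open ≡-Reasoning

  1≤density : ∀ μ w → mass w ≤ μ w → 1# ≤ density μ w
  1≤density μ w mass≤μ with mass w ≟ 0#
  ... | yes _ = ≤-refl
  ... | no ≢0 = subst (_≤ μ w * mass w ⁻¹) (⁻¹-inverseʳ (mass w) ≢0)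
                  (*-monoʳ-≤ (⁻¹-nonneg (mass≥0 w) ≢0) mass≤μ)

  -- Since `null` makes density times mass equal to `μ` everywhere, fairness is just the additivity
  -- of `μ`.
  density-martingale : ∀ {μ} → IsMeasure μ → (∀ w → mass w ≡ 0# → μ w ≡ 0#) → Martingale ν
  density-martingale {μ} isμ null = martingale (density μ) (density-nonneg isμ , λ w →
    trans (density*mass μ w (null w)) (trans (isμ .additive w)
      (sym (cong₂ _+_ (density*mass μ _ (null _)) (density*mass μ _ (null _))))))

  _⊕_ : Martingale ν → Martingale ν → Martingale ν
  d ⊕ e = martingale (λ w → value d w + value e w)
    ((λ w → +-nonneg (value≥0 ν d w) (value≥0 ν e w)) , sum-fair)
    where
    open ≡-Reasoning
    sum-fair : ∀ w → let w₀ = w ∷ʳ false; w₁ = w ∷ʳ true in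
      (value d w + value e w) * mass w ≡
      (value d w₀ + value e w₀) * mass w₀ + (value d w₁ + value e w₁) * mass w₁
    sum-fair w = begin
      (value d w + value e w) * mass w
        ≡⟨ distribʳ (mass w) (value d w) (value e w) ⟩
      value d w * mass w + value e w * mass w
        ≡⟨ cong₂ _+_ (fair ν d w) (fair ν e w) ⟩
      (value d w₀ * mass w₀ + value d w₁ * mass w₁) + (value e w₀ * mass w₀ + value e w₁ * mass w₁)
        ≡⟨ +-interchange _ _ _ _ ⟩
      (value d w₀ * mass w₀ + value e w₀ * mass w₀) + (value d w₁ * mass w₁ + value e w₁ * mass w₁)
        ≡⟨ cong₂ _+_ (distribʳ (mass w₀) _ _) (distribʳ (mass w₁) _ _) ⟨
      (value d w₀ + value e w₀) * mass w₀ + (value d w₁ + value e w₁) * mass w₁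
        ∎
      where
      w₀ w₁ : String
      w₀ = w ∷ʳ false
      w₁ = w ∷ʳ true

  S¹-⊕ : ∀ d e → S¹ d ∪ S¹ e ⊆ S¹ (d ⊕ e)
  S¹-⊕ d e (inj₁ (n , 1≤d)) = n , ≤-trans 1≤d (x≤x+y (value≥0 ν e _))
  S¹-⊕ d e (inj₂ (n , 1≤e)) = n , ≤-trans 1≤e (y≤x+y (value≥0 ν d _))

  -- Weighting by `ν` turns fairness into additivity, so Kraft's inequality becomes available, with
  -- `d(λ)` as total mass.
  capital : Martingale ν → String → ℝ
  capital d w = value d w * mass w

  capital-isMeasure : ∀ d → IsMeasure (capital d)
  capital-isMeasure d .nonneg   w = *-nonneg (value≥0 ν d w) (mass≥0 w)
  capital-isMeasure d .additive   = fair ν d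

  mass≤capital : ∀ d {w} → 1# ≤ value d w → mass w ≤ capital d w
  mass≤capital d {w} 1≤d = subst (_≤ capital d w) (*-identityˡ (mass w)) (*-monoʳ-≤ (mass≥0 w) 1≤d)

  outer-isInf : ∀ X → IsInf (OpenCoverMeasure ν X) (outer X)
  outer-isInf X = proj₂
    (inf-complete (OpenCoverMeasure ν X) (1# , wholeSpace ν X) (0# , 0≤OpenCoverMeasure ν X))

  outer-mono : ∀ {X Y} → X ⊆ Y → outer X ≤ outer Y
  outer-mono {X} {Y} X⊆Y = proj₂ (outer-isInf Y) (outer X) λ { m (Z , Y⊆Z , Zm) →
    proj₁ (outer-isInf X) m (Z , (λ x → Y⊆Z (X⊆Y x)) , Zm) }

  -- The martingale is the density of `ν` restricted to the open cover. It is at least 1 at every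
  -- string of `B`, and its initial value is the total mass of the restriction because `ν(λ) = 1`.
  openCover⇒martingale : ∀ {X m} → OpenCoverMeasure ν X m →
                         ∃ λ d → X ⊆ S¹ d × value d [] ≤ m
  openCover⇒martingale {X} {m} (Y , X⊆Y , B , _ , (Y⊆B , _) , m-ub , _) =
    density-martingale total-isMeasure total-null , covered , initial
    where
    open OpenSetMeasure mass-isMeasure B {m} (λ l l! Bl → m-ub _ (l , l! , Bl , refl))
    covered : X ⊆ S¹ (density-martingale total-isMeasure total-null)
    covered A∈X with w , Bw , w≡A ← Y⊆B (X⊆Y A∈X) =
      length w , subst (λ u → 1# ≤ density total-measure u) w≡A
                   (1≤density total-measure w (μ≤total Bw))
    open ≤-Reasoning
    initial : density total-measure [] ≤ m
    initial = begin
      density total-measure []            ≡⟨ x*mass[]≡x _ ⟨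
      density total-measure [] * mass []  ≡⟨ density*mass total-measure [] (total-null []) ⟩
      total-measure []                    ≤⟨ total≤bound [] ⟩
      m                                   ∎

  outer≤initial : ∀ {X} d → X ⊆ S¹ d → outer X ≤ value d []
  outer≤initial {X} d X⊆S¹ = let m , isSum = sum in
    ≤-trans
      (proj₁ (outer-isInf X) m
        (Cylinders B , covers , B , Minimal-prefixSet _ , ((λ c → c) , (λ c → c)) , isSum))
      (proj₂ isSum (value d []) bound)
    where
    -- Minimality yields a prefix set, and no cylinder is lost: each string with `d(w) ≥ 1` extends
    -- a minimal one.
    B : Pred String 0ℓ
    B = Minimal (λ w → 1# ≤ value d w)
    bound : UpperBound (PartialSum ν B) (value d [])
    bound _ (l , l! , Bl , refl) = begin
      ∑ l mass         ≤⟨ ∑-mono-≤ (All.map (mass≤capital d ∘ proj₁) Bl) ⟩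
      ∑ l (capital d)  ≤⟨ kraft (capital-isMeasure d) (Minimal-prefixSet _) l! Bl ⟩
      capital d []     ≡⟨ x*mass[]≡x _ ⟩
      value d []       ∎
      where open ≤-Reasoning
    sum : ∃ (IsSum ν B)
    sum = sup-complete₀ (PartialSum ν B) (_ , [] , [] , [] , refl) (_ , bound)
    covers : X ⊆ Cylinders B
    covers {A} A∈X with n , 1≤d ← X⊆S¹ A∈X
      with u , Bu , u⊑A ← minimal-prefix (λ w → 1# ≤? value d w) (A ↾ n) 1≤d
      = u , Bu , Prefix-↾ A n u⊑A

  approximate : ∀ X r → ∃ λ d → X ⊆ S¹ d × value d [] ≤ outer X + 2^- r
  -- Without such a martingale, `outer X + 2^- r` would bound all open covers from below and so
  -- exceed their infimum.
  approximate X r = decidable-stable em₀ λ none →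
    2^-≰0 r (x+y≤x⇒y≤0 (proj₂ (outer-isInf X) (outer X + 2^- r) (bound none)))
    where
    bound : ¬ (∃ λ d → X ⊆ S¹ d × value d [] ≤ outer X + 2^- r) →
            LowerBound (OpenCoverMeasure ν X) (outer X + 2^- r)
    bound none m cover with total (outer X + 2^- r) m
    ... | inj₁ ≤m = ≤m
    ... | inj₂ m≤ with d , X⊆S¹ , d≤m ← openCover⇒martingale cover =
      ⊥-elim (none (d , X⊆S¹ , ≤-trans d≤m m≤))

  -- Each set is allowed the error `2^-(r+1)`, so that together they stay within the tolerance of a
  -- splitting operator.
  approximate₂ : ∀ X Y r → ∃ λ d → ∃ λ e →
    X ⊆ S¹ d × Y ⊆ S¹ e × value d [] + value e [] ≤ (outer X + outer Y) + 2^- r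
  approximate₂ X Y r
    with d , X⊆d , d≤ ← approximate X (1+ r) | e , Y⊆e , e≤ ← approximate Y (1+ r)
    = d , e , X⊆d , Y⊆e , (begin
      value d [] + value e []                              ≤⟨ +-mono-≤ d≤ e≤ ⟩
      (outer X + 2^- (1+ r)) + (outer Y + 2^- (1+ r))      ≡⟨ +-interchange _ _ _ _ ⟩
      (outer X + outer Y) + (2^- (1+ r) + 2^- (1+ r))      ≡⟨ cong ((outer X + outer Y) +_) (2^--halves r) ⟩
      (outer X + outer Y) + 2^- r                          ∎)
    where open ≤-Reasoning

  -- Near-optimal martingales for `X` and `Y` add up to one that covers `Z`.
  outer-subadditive : ∀ {X Y Z} → Z ⊆ X ∪ Y → outer Z ≤ outer X + outer Y
  outer-subadditive {X} {Y} {Z} Z⊆ = ≤+2^-⇒≤ λ r →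
    let d , e , X⊆d , Y⊆e , le = approximate₂ X Y r in
    ≤-trans (outer≤initial (d ⊕ e) λ z → S¹-⊕ d e (Sum.map X⊆d Y⊆e (Z⊆ z))) le

  -- If d(λ) < 1, some sequence A keeps d(w) ν(w) < ν(w) along all its prefixes w.
  1≤initial : ∀ d → U ⊆ S¹ d → 1# ≤ value d []
  1≤initial d U⊆S¹ with 1# ≤? value d []
  ... | yes 1≤d[] = 1≤d[]
  ... | no  1≰d[] = contradiction (mass≤capital d 1≤d) losing
    where
    Losing : Pred String 0ℓ
    Losing w = ¬ mass w ≤ capital d w
    step : ∀ w → Losing w → ∃ λ a → Losing (w ∷ʳ a)
    step w losing with mass (w ∷ʳ false) ≤? capital d (w ∷ʳ false)
    ... | no  lt = false , lt
    -- If neither child were losing, adding the two inequalities would show by fairness that `w` is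
    -- not losing either.
    ... | yes le₀ = true , λ le₁ → losing (begin
      mass w                                            ≡⟨ mass-additive w ⟩
      mass (w ∷ʳ false) + mass (w ∷ʳ true)              ≤⟨ +-mono-≤ le₀ le₁ ⟩
      capital d (w ∷ʳ false) + capital d (w ∷ʳ true)    ≡⟨ fair ν d w ⟨
      capital d w                                       ∎)
      where open ≤-Reasoning
    path : ℕ → ∃ Losing
    path zero   = [] , λ le → 1≰d[] (subst (1# ≤_) (x*mass[]≡x _) (subst (_≤ capital d []) mass-λ le))
    path (1+ n) = let w , losing = path n in _ , proj₂ (step w losing)
    A : Cantor
    A n = let w , losing = path n in proj₁ (step w losing)
    A↾≡path : ∀ n → A ↾ n ≡ proj₁ (path n)
    A↾≡path zero   = refl
    A↾≡path (1+ n) = trans (sym (applyUpTo-∷ʳ A n)) (cong (_∷ʳ A n) (A↾≡path n))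
    -- The length at which `d` is assumed to reach 1 on `A`, contrary to the choice of the path.
    n : ℕ
    n = proj₁ (U⊆S¹ {A} _)
    1≤d : 1# ≤ value d (A ↾ n)
    1≤d = proj₂ (U⊆S¹ {A} _)
    losing : Losing (A ↾ n)
    losing = subst Losing (sym (A↾≡path n)) (proj₂ (path n))

  1≤outer-U : 1# ≤ outer U
  1≤outer-U = ≤+2^-⇒≤ λ r → let d , U⊆S¹ , d≤ = approximate U r in ≤-trans (1≤initial d U⊆S¹) d≤

  -- From measurements to classical measurability and measure.

  module _ {X : Pred Cantor 0ℓ} (M : AllMeasurement ν X) where
    open SplittingOperator M

    outer-splits : ∀ {Y} r d → Y ⊆ S¹ d → outer (Y ∩ X) + outer (Y ∖ X) ≤ value d [] + 2^- r
    outer-splits r d Y⊆S¹ = ≤-trans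
      (+-mono-≤ (outer≤initial (Φ⁺ r d) λ (y , x) → covers⁺ r d (x , Y⊆S¹ y))
                (outer≤initial (Φ⁻ r d) λ (y , ¬x) → covers⁻ r d (¬x , Y⊆S¹ y)))
      (splits r d)

    -- Subadditivity gives one inequality. For the other, every open cover of `Y` becomes a
    -- martingale that the operator splits; the error vanishes as `r` grows, and the infimum over
    -- covers is taken last.
    allMeasurable⇒measurable : Measurable ν X
    allMeasurable⇒measurable Y = ≤-antisym
      (outer-subadditive λ {A} y → split y em₀)
      (proj₂ (outer-isInf Y) _ λ m cover → let d , Y⊆S¹ , d≤m = openCover⇒martingale cover in
        ≤-trans (≤+2^-⇒≤ λ r → outer-splits r d Y⊆S¹) d≤m)
      where
      split : ∀ {A} → A ∈ Y → Dec (A ∈ X) → A ∈ (Y ∩ X) ∪ (Y ∖ X)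
      split y (yes x) = inj₁ (y , x)
      split y (no ¬x) = inj₂ (y , ¬x)

    Φ⁺∞-isInf : IsInf (InitialValue ν M) (Φ⁺∞ ν M)
    Φ⁺∞-isInf = proj₂ (inf-complete (InitialValue ν M) _ _)

    ∈S¹-𝟏 : ∀ A → A ∈ S¹ (𝟏 ν)
    ∈S¹-𝟏 _ = 0 , ≤-refl

    outer≤Φ⁺ : ∀ r → outer X ≤ value (Φ⁺ r (𝟏 ν)) []
    outer≤Φ⁺ r = outer≤initial (Φ⁺ r (𝟏 ν)) λ {A} x → covers⁺ r (𝟏 ν) (x , ∈S¹-𝟏 A)

    outer≤Φ⁻ : ∀ r → outer (U ∖ X) ≤ value (Φ⁻ r (𝟏 ν)) []
    outer≤Φ⁻ r = outer≤initial (Φ⁻ r (𝟏 ν)) λ {A} (_ , ¬x) → covers⁻ r (𝟏 ν) (¬x , ∈S¹-𝟏 A)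

    -- The infimum lies below every `Φ⁺ r 𝟏`, so the splitting bound for `𝟏`, which starts at 1,
    -- holds for it at every `r`.
    Φ⁺∞+outer≤1 : Φ⁺∞ ν M + outer (U ∖ X) ≤ 1#
    Φ⁺∞+outer≤1 = ≤+2^-⇒≤ λ r → ≤-trans
      (+-mono-≤ (proj₁ Φ⁺∞-isInf _ (lift (r , refl))) (outer≤Φ⁻ r))
      (splits r (𝟏 ν))

    -- The lower bound holds because every `Φ⁺ r 𝟏` covers `X`. The upper bound comes from the
    -- complement: it costs the same on both sides of `Φ⁺∞ + ν*(Xᶜ) ≤ 1 ≤ ν*(X) + ν*(Xᶜ)` and
    -- cancels.
    allMeasure≡measure : (c : Measurable ν X) → allMeasure ν X M ≡ measure ν X c
    allMeasure≡measure c = ≤-antisym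
      (≤-trans (+-cancelʳ-≤ (outer (U ∖ X)) (begin
        Φ⁺∞ ν M + outer (U ∖ X)        ≤⟨ Φ⁺∞+outer≤1 ⟩
        1#                             ≤⟨ 1≤outer-U ⟩
        outer U                        ≡⟨ c U ⟩
        outer (U ∩ X) + outer (U ∖ X)  ∎)) (outer-mono proj₂))
      (proj₂ Φ⁺∞-isInf _ λ { _ (lift (r , refl)) → outer≤Φ⁺ r })
      where open ≤-Reasoning

  -- From classical measurability to a measurement.

  measurable⇒allMeasurable : ∀ {X} → Measurable ν X → AllMeasurable ν X
  measurable⇒allMeasurable {X} c = record
    { Φ       = λ r d → let e⁺ , e⁻ , _ = approx r d in e⁺ , e⁻
    ; covers⁺ = λ r d (x , s) → let _ , _ , ⊆⁺ , _ = approx r d in ⊆⁺ (s , x)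
    ; covers⁻ = λ r d (¬x , s) → let _ , _ , _ , ⊆⁻ , _ = approx r d in ⊆⁻ (s , ¬x)
    ; splits  = λ r d → let _ , _ , _ , _ , le = approx r d in ≤-trans le
        -- Measurability is used with the test set `S¹ d`, whose outer measure is at most `d(λ)`
        -- since `d` covers it.
        (+-monoˡ-≤ (2^- r) (subst (_≤ value d []) (c (S¹ d)) (outer≤initial d λ s → s)))
    }
    where approx = λ r d → approximate₂ (S¹ d ∩ X) (S¹ d ∖ X) r

theorem4p6 : ExcludedMiddle (suc 0ℓ) → Extensionality 0ℓ 0ℓ →
    (R : CompleteOrderedField) (ν : ProbabilityMeasure R) (X : Pred Cantor 0ℓ) →
    (AllMeasurable ν X ⇔ Measurable ν X) ×
    ((a : AllMeasurable ν X) (c : Measurable ν X) → allMeasure ν X a ≡ measure ν X c)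
theorem4p6 em _ R ν X = mk⇔ allMeasurable⇒measurable measurable⇒allMeasurable , allMeasure≡measure
  where open OuterMeasure em R ν
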